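{- Let $a,b$ be integers with $0<a<b$. Let $\Gamma_{a,b}=\{\gamma_1,\gamma_2,\gamma_3,\dots\}$ be the sequence produced by the greedy algorithm: $\gamma_1=a$, $\gamma_2=b$, and for $r\ge 3$, $\gamma_r$ is the smallest integer greater than $\gamma_{r-1}$ such that $\{\gamma_1,\dots,\gamma_r\}$ is dissociated. Then there is an integer $n_0=n_0(a,b)$ such that $\gamma_n = 2\gamma_{n-1}$ for all $n\ge n_0$.
   Context: A set $\mathcal S\subseteq\mathbb N$ is dissociated if all of its finite subsets have different sums; equivalently, any equality $\sum_{s\in\mathcal S}\varepsilon_s s=0$ with $\varepsilon_s\in\{ -1,0,1\}$ and only finitely many $\varepsilon_s\neq 0$ forces all $\varepsilon_s=0$. -}

module Defs where

open import Data.List.Base using (sum)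
open import Data.List.Relation.Binary.BagAndSetEquality using (_∼[_]_; set)
open import Data.List.Relation.Unary.All using (All)
open import Data.List.Relation.Unary.Unique.Propositional using (Unique)
open import Data.Nat.Base using (ℕ; suc; _≤_; _<_)
open import Data.Product.Base using (∃-syntax; _×_)
open import Level using (Level)
open import Relation.Binary.PropositionalEquality.Core using (_≡_)
open import Relation.Unary using (Pred; _∪_; ｛_｝)

private
  variable
    ℓ : Level

-- Finite subsets of S are represented by duplicate-free lists of elements
-- of S, compared as sets (not as lists).
Dissociated : Pred ℕ ℓ → Set ℓ
Dissociated S = ∀ {xs ys} → Unique xs → Unique ys → All S xs → All S ys →
                sum xs ≡ sum ys → xs ∼[ set ] ys

IsLeast : Pred ℕ ℓ → ℕ → Set ℓ
IsLeast P m = P m × (∀ k → P k → m ≤ k)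

-- The set {γ₁, …, γᵣ}.  Sequences are indexed from 1; γ 0 is a junk value.
Terms : (ℕ → ℕ) → ℕ → Pred ℕ _
Terms γ r x = ∃[ i ] (1 ≤ i × i ≤ r × γ i ≡ x)

record IsGreedy (a b : ℕ) (γ : ℕ → ℕ) : Set where
  field
    first  : γ 1 ≡ a
    second : γ 2 ≡ b
    next   : ∀ r → 2 ≤ r →
             IsLeast (λ m → γ r < m × Dissociated (Terms γ r ∪ ｛ m ｝)) (γ (suc r))

{-# OPTIONS --safe #-}
module Submission where

-- Let D_r be the set of all signed sums Σ_{i≤r} εᵢ γᵢ with εᵢ ∈ {-1,0,1} and
-- M_r = γ₁ + ⋯ + γᵣ its maximum.  For m > γᵣ, the set {γ₁, …, γᵣ, m} is
-- dissociated iff m ∉ D_r, so γᵣ₊₁ is the least m > γᵣ outside D_r.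
-- Every k with b ≤ k < γᵣ₊₁ is thus in D_r, and so, by subtracting from a term
-- γᵣ ≥ 2b, is every k < b once r is large.  From then on
-- D_r ⊇ [0, γᵣ₊₁), which gives D_{r+1} ⊇ [0, 2γᵣ₊₁) and γᵣ₊₂ ≥ 2γᵣ₊₁;
-- consequently M_r - γᵣ₊₁ no longer increases.  As soon as
-- γᵣ₊₁ exceeds this bounded excess, M_r < 2γᵣ₊₁, hence 2γᵣ₊₁ ∉ D_{r+1} and
-- γᵣ₊₂ = 2γᵣ₊₁.

open import Data.List.Base using (List; []; _∷_)
open import Data.List.Relation.Binary.BagAndSetEquality
  using (∷-cong; bag-=⇒; ↭⇒∼bag)
open import Data.List.Relation.Binary.Permutation.Propositional
  using (_↭_; prep; swap) renaming (refl to ↭-refl; trans to ↭-trans)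
open import Data.List.Relation.Binary.Permutation.Propositional.Properties
  using (All-resp-↭)
open import Data.List.Relation.Unary.All as All using (All; []; _∷_)
open import Data.List.Relation.Unary.AllPairs using ([]; _∷_)
open import Data.List.Relation.Unary.Any using (here)
open import Data.List.Relation.Unary.Unique.Propositional using (Unique)
open import Data.Nat.Base
  using (ℕ; zero; suc; _+_; _*_; _∸_; _≤_; _<_; z≤n; s≤s)
open import Data.Nat.ListAction using (sum)
open import Data.Nat.ListAction.Properties using (sum-↭)
open import Data.Nat.Properties
open import Data.Nat.Tactic.RingSolver using (solve-∀)
open import Data.Product.Base using (∃-syntax; _×_; _,_; proj₁; proj₂)
open import Data.Sum.Base using (_⊎_; inj₁; inj₂)
open import Function.Bundles using (Equivalence)
open import Function.Related.Propositional using (K-trans; SK-sym)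
open import Level using (Level)
open import Relation.Binary.Definitions using (tri<; tri≈; tri>)
open import Relation.Binary.PropositionalEquality.Core
  using (_≡_; _≢_; refl; sym; trans; cong; subst; subst₂)
open import Relation.Nullary using (¬_; Dec; yes; no; contradiction)
open import Relation.Nullary.Decidable using (_⊎-dec_; decidable-stable)
open import Relation.Unary using (Pred; _∪_; ｛_｝)
open import Defs

private
  variable
    ℓ : Level
    P : Pred ℕ ℓ
    v : ℕ
    xs : List ℕ

-- Adjoining one element to a dissociated set.

extract : Unique xs → All (P ∪ ｛ v ｝) xs →
          All P xs ⊎ ∃[ zs ] (xs ↭ v ∷ zs × Unique zs × All P zs)
extract [] [] = inj₁ []
-- By uniqueness no later entry equals `v`, so the tail lies entirely in `P`.
extract {P = P} {v = v} (v∉xs ∷ uxs) (inj₂ refl ∷ axs) =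
  inj₂ (_ , ↭-refl , uxs , All.zipWith drop (v∉xs , axs))
  where
  drop : ∀ {x} → v ≢ x × (P ∪ ｛ v ｝) x → P x
  drop (_   , inj₁ px)  = px
  drop (v≢x , inj₂ v≡x) = contradiction v≡x v≢x
extract (x∉xs ∷ uxs) (inj₁ px ∷ axs) with extract uxs axs
... | inj₁ pxs = inj₁ (px ∷ pxs)
... | inj₂ (zs , p , uzs , pzs) =
  inj₂ (_ , ↭-trans (prep _ p) (swap _ _ ↭-refl) ,
        All.tail (All-resp-↭ p x∉xs) ∷ uzs , px ∷ pzs)

-- For the set of γ₁, ..., γᵣ this is `v` ∉ D_r. Adding `sum xs` on the left avoids truncated
-- subtraction.
NotDifference : Pred ℕ ℓ → ℕ → Set ℓ
NotDifference P v = ∀ {xs ys} → Unique xs → Unique ys → All P xs → All P ys →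
                    v + sum xs ≢ sum ys

-- If `v` lies in both lists it cancels; if in exactly one, equal sums make `v` a difference of two
-- subset sums of `P`.
dissociated-∪⁺ : Dissociated P → NotDifference P v → Dissociated (P ∪ ｛ v ｝)
dissociated-∪⁺ {v = v} dis nd uxs uys axs ays eq
  with extract uxs axs | extract uys ays
... | inj₁ pxs | inj₁ pys = dis uxs uys pxs pys eq
... | inj₁ pxs | inj₂ (_ , q , uzs , pzs) =
  contradiction (sym (trans eq (sum-↭ q))) (nd uzs uxs pzs pxs)
... | inj₂ (_ , p , uzs , pzs) | inj₁ pys =
  contradiction (trans (sym (sum-↭ p)) eq) (nd uzs uys pzs pys)
... | inj₂ (_ , p , uzs , pzs) | inj₂ (_ , q , uws , pws) =
  K-trans (bag-=⇒ (↭⇒∼bag p))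
    (K-trans (∷-cong refl (dis uzs uws pzs pws sums))
             (SK-sym (bag-=⇒ (↭⇒∼bag q))))
  where sums = +-cancelˡ-≡ v _ _ (trans (sym (sum-↭ p)) (trans eq (sum-↭ q)))

-- If `v + sum xs ≡ sum ys`, dissociation would force `v` into `ys`, hence into `P`.
dissociated-∪⁻ : ¬ P v → Dissociated (P ∪ ｛ v ｝) → NotDifference P v
dissociated-∪⁻ {P = P} {v = v} ¬pv dis uxs uys pxs pys eq =
  ¬pv (All.lookup pys
        (Equivalence.to (dis (All.map fresh pxs ∷ uxs) uys
          (inj₂ refl ∷ All.map inj₁ pxs) (All.map inj₁ pys) eq) (here refl)))
  where
  fresh : ∀ {x} → P x → v ≢ x
  fresh px refl = ¬pv px

dissociated-⊆ : ∀ {ℓ′} {Q : Pred ℕ ℓ′} → (∀ {x} → Q x → P x) →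
                Dissociated P → Dissociated Q
dissociated-⊆ Q⊆P dis uxs uys qxs qys =
  dis uxs uys (All.map Q⊆P qxs) (All.map Q⊆P qys)

-- Signed sums of the first terms.

module SignedSums (γ : ℕ → ℕ) where

  -- x − y ∈ D_r, with negative values avoided by moving terms across.
  Diff : ℕ → ℕ → ℕ → Set
  Diff zero    x y = x ≡ y
  Diff (suc r) x y =
    Diff r x y ⊎ Diff r (γ (suc r) + x) y ⊎ Diff r x (γ (suc r) + y)

  -- Decidability makes membership in D_r stable under double negation, so skipped integers can be
  -- placed in D_r constructively.
  diff? : ∀ r x y → Dec (Diff r x y)
  diff? zero    x y = x ≟ y
  diff? (suc r) x y =
    diff? r x y ⊎-dec (diff? r (γ (suc r) + x) y ⊎-dec diff? r x (γ (suc r) + y))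

  diff-refl : ∀ r {x} → Diff r x x
  diff-refl zero    = refl
  diff-refl (suc r) = inj₁ (diff-refl r)

  diff-sym : ∀ r {x y} → Diff r x y → Diff r y x
  diff-sym zero    d               = sym d
  diff-sym (suc r) (inj₁ d)        = inj₁ (diff-sym r d)
  diff-sym (suc r) (inj₂ (inj₁ d)) = inj₂ (inj₂ (diff-sym r d))
  diff-sym (suc r) (inj₂ (inj₂ d)) = inj₂ (inj₁ (diff-sym r d))

  private
    swap-+ : ∀ g c x → g + (c + x) ≡ c + (g + x)
    swap-+ = solve-∀

  diff-+⁺ : ∀ r c {x y} → Diff r x y → Diff r (c + x) (c + y)
  diff-+⁺ zero    c d = cong (c +_) d
  diff-+⁺ (suc r) c (inj₁ d) = inj₁ (diff-+⁺ r c d)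
  diff-+⁺ (suc r) c {x} {y} (inj₂ (inj₁ d)) = inj₂ (inj₁
    (subst (λ z → Diff r z (c + y)) (swap-+ c (γ (suc r)) x) (diff-+⁺ r c d)))
  diff-+⁺ (suc r) c {x} {y} (inj₂ (inj₂ d)) = inj₂ (inj₂
    (subst (Diff r (c + x)) (swap-+ c (γ (suc r)) y) (diff-+⁺ r c d)))

  diff-+⁻ : ∀ r c {x y} → Diff r (c + x) (c + y) → Diff r x y
  diff-+⁻ zero    c d = +-cancelˡ-≡ c _ _ d
  diff-+⁻ (suc r) c (inj₁ d) = inj₁ (diff-+⁻ r c d)
  diff-+⁻ (suc r) c {x} {y} (inj₂ (inj₁ d)) = inj₂ (inj₁ (diff-+⁻ r c
    (subst (λ z → Diff r z (c + y)) (swap-+ (γ (suc r)) c x) d)))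
  diff-+⁻ (suc r) c {x} {y} (inj₂ (inj₂ d)) = inj₂ (inj₂ (diff-+⁻ r c
    (subst (Diff r (c + x)) (swap-+ (γ (suc r)) c y) d)))

  total : ℕ → ℕ
  total zero    = 0
  total (suc r) = γ (suc r) + total r

  diff-bound : ∀ r {x y} → Diff r x y → x ≤ total r + y
  diff-bound zero    refl     = ≤-refl
  diff-bound (suc r) (inj₁ d) =
    ≤-trans (diff-bound r d) (+-monoˡ-≤ _ (m≤n+m _ (γ (suc r))))
  diff-bound (suc r) {x} (inj₂ (inj₁ d)) =
    ≤-trans (m≤n+m x (γ (suc r)))
      (≤-trans (diff-bound r d) (+-monoˡ-≤ _ (m≤n+m _ (γ (suc r)))))
  diff-bound (suc r) {x} {y} (inj₂ (inj₂ d)) = ≤-trans (diff-bound r d)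
    (≤-reflexive (trans (swap-+ (total r) (γ (suc r)) y)
                        (sym (+-assoc (γ (suc r)) (total r) y))))

  terms-suc⁻ : ∀ {r x} → Terms γ (suc r) x → (Terms γ r ∪ ｛ γ (suc r) ｝) x
  terms-suc⁻ (i , 1≤i , i≤1+r , eq) with m≤n⇒m<n∨m≡n i≤1+r
  ... | inj₁ (s≤s i≤r) = inj₁ (i , 1≤i , i≤r , eq)
  ... | inj₂ refl      = inj₂ eq

  terms-suc⁺ : ∀ {r x} → (Terms γ r ∪ ｛ γ (suc r) ｝) x → Terms γ (suc r) x
  terms-suc⁺ (inj₁ (i , 1≤i , i≤r , eq)) = i , 1≤i , m≤n⇒m≤1+n i≤r , eq
  terms-suc⁺ (inj₂ eq)                   = _ , s≤s z≤n , ≤-refl , eq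

  no-terms : ∀ {xs} → All (Terms γ 0) xs → xs ≡ []
  no-terms []                        = refl
  no-terms ((i , 1≤i , i≤0 , _) ∷ _) = contradiction (≤-trans 1≤i i≤0) λ ()

  -- A term in both lists or in neither gets coefficient 0, one only in `xs` gets 1, one only in
  -- `ys` gets -1.
  sums⇒diff : ∀ r {xs ys} → Unique xs → Unique ys →
              All (Terms γ r) xs → All (Terms γ r) ys → Diff r (sum xs) (sum ys)
  sums⇒diff zero    uxs uys txs tys
    with refl ← no-terms txs | refl ← no-terms tys = refl
  sums⇒diff (suc r) {xs} {ys} uxs uys txs tys
    with extract uxs (All.map terms-suc⁻ txs) | extract uys (All.map terms-suc⁻ tys)
  ... | inj₁ pxs | inj₁ pys = inj₁ (sums⇒diff r uxs uys pxs pys)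
  ... | inj₁ pxs | inj₂ (zs , q , uzs , pzs) =
    inj₂ (inj₁ (subst (Diff r _) (sym (sum-↭ q))
      (diff-+⁺ r (γ (suc r)) (sums⇒diff r uxs uzs pxs pzs))))
  ... | inj₂ (zs , p , uzs , pzs) | inj₁ pys =
    inj₂ (inj₂ (subst (λ s → Diff r s _) (sym (sum-↭ p))
      (diff-+⁺ r (γ (suc r)) (sums⇒diff r uzs uys pzs pys))))
  ... | inj₂ (zs , p , uzs , pzs) | inj₂ (ws , q , uws , pws) =
    inj₁ (subst₂ (Diff r) (sym (sum-↭ p)) (sym (sum-↭ q))
      (diff-+⁺ r (γ (suc r)) (sums⇒diff r uzs uws pzs pws)))

  module _ (fresh : ∀ r → ¬ Terms γ r (γ (suc r))) where

    -- Terms with coefficient -1 are collected in `xs`, those with 1 in `ys`; `fresh` keeps both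
    -- lists duplicate-free.
    diff⇒sums : ∀ r {x y} → Diff r x y →
                ∃[ xs ] ∃[ ys ] (Unique xs × Unique ys ×
                  All (Terms γ r) xs × All (Terms γ r) ys × x + sum xs ≡ y + sum ys)
    diff⇒sums zero    refl = [] , [] , [] , [] , [] , [] , refl
    diff⇒sums (suc r) d = step d
      where
      g = γ (suc r)

      new : ∀ {xs} → All (Terms γ r) xs → Unique xs → Unique (g ∷ xs)
      new txs uxs = All.map (λ { t refl → fresh r t }) txs ∷ uxs

      old : ∀ {xs} → All (Terms γ r) xs → All (Terms γ (suc r)) xs
      old = All.map (λ t → terms-suc⁺ (inj₁ t))

      last : Terms γ (suc r) g
      last = terms-suc⁺ (inj₂ refl)

      move : ∀ x s → x + (g + s) ≡ g + x + s
      move x s = trans (swap-+ x g s) (sym (+-assoc g x s))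

      step : ∀ {x y} → Diff (suc r) x y →
             ∃[ xs ] ∃[ ys ] (Unique xs × Unique ys ×
               All (Terms γ (suc r)) xs × All (Terms γ (suc r)) ys ×
               x + sum xs ≡ y + sum ys)
      step (inj₁ d) with diff⇒sums r d
      ... | xs , ys , uxs , uys , txs , tys , eq =
        xs , ys , uxs , uys , old txs , old tys , eq
      step {x} (inj₂ (inj₁ d)) with diff⇒sums r d
      ... | xs , ys , uxs , uys , txs , tys , eq =
        g ∷ xs , ys , new txs uxs , uys , last ∷ old txs , old tys ,
        trans (move x (sum xs)) eq
      step {y = y} (inj₂ (inj₂ d)) with diff⇒sums r d
      ... | xs , ys , uxs , uys , txs , tys , eq =
        xs , g ∷ ys , uxs , new tys uys , old txs , last ∷ old tys ,
        trans eq (sym (move y (sum ys)))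

  ¬diff⇒notDifference : ∀ r {m} → ¬ Diff r m 0 → NotDifference (Terms γ r) m
  ¬diff⇒notDifference r {m} ¬d {xs} uxs uys txs tys eq =
    ¬d (diff-+⁻ r (sum xs) (subst₂ (Diff r) (trans (sym eq) (+-comm m (sum xs)))
         (sym (+-identityʳ (sum xs))) (sums⇒diff r uys uxs tys txs)))

-- Iterates M ↦ 2M + 1 from `s`. It does not mention γ, so the threshold can be fixed before the
-- sequence is given.
totalBound : ℕ → ℕ → ℕ
totalBound s zero    = s
totalBound s (suc j) = suc (totalBound s j) + totalBound s j

-- The greedy sequence in terms of signed sums.

module Greedy {a b : ℕ} (0<a : 0 < a) (a<b : a < b)
              {γ : ℕ → ℕ} (greedy : IsGreedy a b γ) where

  open IsGreedy greedy
  open SignedSums γ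

  increasing : ∀ r → 0 < r → γ r < γ (suc r)
  increasing 1             _ = subst₂ _<_ (sym first) (sym second) a<b
  increasing (suc (suc r)) _ = proj₁ (proj₁ (next (2 + r) (s≤s (s≤s z≤n))))

  terms-< : ∀ r {x} → Terms γ r x → x < γ (suc r)
  terms-< zero (i , 1≤i , i≤0 , _) = contradiction (≤-trans 1≤i i≤0) λ ()
  terms-< (suc r) t with terms-suc⁻ t
  ... | inj₁ t′   = <-trans (terms-< r t′) (increasing (suc r) (s≤s z≤n))
  ... | inj₂ refl = increasing (suc r) (s≤s z≤n)

  fresh : ∀ r → ¬ Terms γ r (γ (suc r))
  fresh r t = <-irrefl refl (terms-< r t)

  0<b : 0 < b
  0<b = <-trans 0<a a<b

  -- From the third term on this is dissociation of the enlarged set; the prescribed terms γ₁ and γ₂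
  -- use 0 < a < b directly.
  γ∉D : ∀ r → ¬ Diff r (γ (suc r)) 0
  γ∉D 0 d = <⇒≢ 0<a (sym (trans (sym first) d))
  γ∉D 1 d with subst₂ (λ x y → Diff 1 x y) second refl d
  ... | inj₁ b≡0        = <⇒≢ 0<b (sym b≡0)
  ... | inj₂ (inj₁ s≡0) = <⇒≢ 0<b (sym (m+n≡0⇒n≡0 (γ 1) s≡0))
  ... | inj₂ (inj₂ b≡a) =
    <⇒≢ a<b (sym (trans b≡a (trans (+-identityʳ (γ 1)) first)))
  γ∉D r@(suc (suc _)) d with diff⇒sums fresh r d
  ... | _ , _ , uxs , uys , txs , tys , eq =
    dissociated-∪⁻ (fresh r) (proj₂ (proj₁ (next r (s≤s (s≤s z≤n)))))
      uxs uys txs tys eq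

  terms-dissociated : ∀ r → Dissociated (Terms γ r)
  terms-dissociated zero _ _ txs tys _
    with refl ← no-terms txs | refl ← no-terms tys = bag-=⇒ (↭⇒∼bag ↭-refl)
  terms-dissociated (suc r) = dissociated-⊆ terms-suc⁻
    (dissociated-∪⁺ (terms-dissociated r) (¬diff⇒notDifference r (γ∉D r)))

  greedy-≤ : ∀ j {m} → γ (2 + j) < m → ¬ Diff (2 + j) m 0 → γ (3 + j) ≤ m
  greedy-≤ j γ<m ¬d = proj₂ (next (2 + j) (s≤s (s≤s z≤n))) _
    (γ<m , dissociated-∪⁺ (terms-dissociated (2 + j)) (¬diff⇒notDifference (2 + j) ¬d))

  gap⊆D : ∀ j {k} → γ (2 + j) < k → k < γ (3 + j) → Diff (2 + j) k 0
  gap⊆D j {k} γ<k k<γ = decidable-stable (diff? (2 + j) k 0)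
    λ ¬d → <⇒≱ k<γ (greedy-≤ j γ<k ¬d)

  -- Intervals contained in D_r.

  +∈D : ∀ r {k} → Diff r k 0 → Diff (suc r) (γ (suc r) + k) 0
  +∈D r d = inj₂ (inj₂ (diff-+⁺ r (γ (suc r)) d))

  γ∈D : ∀ r → Diff (suc r) (γ (suc r)) 0
  γ∈D r = subst (λ x → Diff (suc r) x 0) (+-identityʳ (γ (suc r)))
            (+∈D r (diff-refl r))

  -- D_r is symmetric, so -d is a signed sum too, and k = γᵣ₊₁ - d.
  complement∈D : ∀ r k d → k + d ≡ γ (suc r) → Diff r d 0 → Diff (suc r) k 0
  complement∈D r k d eq dd = inj₂ (inj₂ (subst₂ (Diff r) (+-identityʳ k)
    (trans eq (sym (+-identityʳ _))) (diff-+⁺ r k (diff-sym r dd))))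

  upper⊆D : ∀ j {k} → b ≤ k → k < γ (3 + j) → Diff (2 + j) k 0
  upper⊆D j {k} b≤k k<γ with <-cmp k (γ (2 + j))
  ... | tri≈ _ refl _ = γ∈D (suc j)
  ... | tri> _ _ γ<k  = gap⊆D j γ<k k<γ
  -- The descent through earlier terms ends at γ₂ = b, below which no k ≥ b lies.
  upper⊆D zero    b≤k _ | tri< k<b _ _ =
    contradiction (subst (_ <_) second k<b) (≤⇒≯ b≤k)
  upper⊆D (suc j) b≤k _ | tri< k<γ _ _ = inj₁ (upper⊆D j b≤k k<γ)

  growth : ∀ j → b + j ≤ γ (2 + j)
  growth zero    = ≤-reflexive (trans (+-identityʳ b) (sym second))
  growth (suc j) = subst (_≤ γ (3 + j)) (sym (+-suc b j))
    (≤-trans (s≤s (growth j)) (increasing (2 + j) (s≤s z≤n)))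

  initial⊆D : ∀ j → b ≤ j → ∀ {k} → k < γ (3 + j) → Diff (2 + j) k 0
  initial⊆D zero    b≤0 _ = contradiction (<-≤-trans 0<b b≤0) λ ()
  initial⊆D j@(suc j′) b≤j {k} k<γ with b ≤? k
  ... | yes b≤k = upper⊆D j b≤k k<γ
  ... | no  b≰k = small k (≰⇒> b≰k)
    where
    small : ∀ k → k < b → Diff (2 + j) k 0
    -- Zero is treated apart: its complement would be the term itself, just outside the half-open
    -- interval.
    small zero       _   = diff-refl (2 + j)
    small k@(suc k′) k<b =
      -- Since `γ (2 + j)` ≥ 2b, the complement of k lies between b and `γ (2 + j)`, a range already
      -- covered.
      complement∈D (suc j) k (γ (2 + j) ∸ k) (m+[n∸m]≡n k≤)
        (upper⊆D j′ (m+n≤o⇒m≤o∸n b le) (∸-monoʳ-< {o = 0} (s≤s z≤n) k≤))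
      where
      le : b + k ≤ γ (2 + j)
      le = ≤-trans (+-monoʳ-≤ b (≤-trans (<⇒≤ k<b) b≤j)) (growth j)
      k≤ : k ≤ γ (2 + j)
      k≤ = ≤-trans (m≤n+m k b) le

  -- A next term below 2g would be g + k with k < g; then k ∈ D_{2+j} puts it in D_{3+j}.
  doubling-≥ : ∀ j → b ≤ j → 2 * γ (3 + j) ≤ γ (4 + j)
  doubling-≥ j b≤j = ≮⇒≥ λ γ<2g → γ∉D (3 + j) (subst (λ x → Diff (3 + j) x 0)
    (m+[n∸m]≡n g≤γ) (+∈D (2 + j) (initial⊆D j b≤j (excess γ<2g))))
    where
    g = γ (3 + j)
    g≤γ : g ≤ γ (4 + j)
    g≤γ = <⇒≤ (increasing (3 + j) (s≤s z≤n))
    excess : γ (4 + j) < 2 * g → γ (4 + j) ∸ g < g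
    excess lt = +-cancelˡ-< g _ _ (subst₂ _<_ (sym (m+[n∸m]≡n g≤γ))
                  (cong (g +_) (+-identityʳ g)) lt)

  -- Bounded excess and exact doubling.

  γ≤1+total : ∀ j → γ (3 + j) ≤ suc (total (2 + j))
  -- One more than M_r exceeds every signed sum, hence is an admissible candidate.
  γ≤1+total j = greedy-≤ j (s≤s (m≤m+n _ _)) λ d →
    <⇒≱ (n<1+n _) (subst (suc (total (2 + j)) ≤_) (+-identityʳ _)
      (diff-bound (2 + j) d))

  total≤totalBound : ∀ j → total (2 + j) ≤ totalBound (b + a) j
  total≤totalBound zero = ≤-reflexive
    (subst₂ (λ x y → x + (y + 0) ≡ b + a) (sym second) (sym first)
      (cong (b +_) (+-identityʳ a)))
  total≤totalBound (suc j) = +-mono-≤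
    (≤-trans (γ≤1+total j) (s≤s (total≤totalBound j))) (total≤totalBound j)

  E : ℕ
  E = totalBound (b + a) b

  -- Each step adds g to the total, while the next term exceeds g by at least g, so the excess never
  -- grows.
  total≤γ+excess : ∀ i → total (2 + (i + b)) ≤ γ (3 + (i + b)) + E
  total≤γ+excess zero    = ≤-trans (total≤totalBound b) (m≤n+m _ _)
  total≤γ+excess (suc i) = begin
    g + total (2 + (i + b))  ≤⟨ +-monoʳ-≤ g (total≤γ+excess i) ⟩
    g + (g + E)              ≡⟨ double g E ⟩
    2 * g + E                ≤⟨ +-monoˡ-≤ _ (doubling-≥ (i + b) (m≤n+m b i)) ⟩
    γ (4 + (i + b)) + E      ∎
    where
    open ≤-Reasoning
    g = γ (3 + (i + b))
    double : ∀ x e → x + (x + e) ≡ 2 * x + e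
    double = solve-∀

  doubling-≤ : ∀ i → E ≤ i → γ (4 + (i + b)) ≤ 2 * γ (3 + (i + b))
  doubling-≤ i e≤i = greedy-≤ (suc j) g<2g ¬d
    where
    j = i + b
    g = γ (3 + j)

    e<g : E < g
    -- Linear growth suffices: g ≥ b + (j + 1) > i ≥ `E`.
    e<g = ≤-trans (s≤s (≤-trans e≤i (m≤m+n i b)))
           (≤-trans (m≤n+m (suc j) b) (growth (suc j)))

    g<2g : g < 2 * g
    g<2g = m<m+n g (≤-trans (≤-<-trans z≤n e<g) (m≤m+n g 0))

    total<2g : total (2 + j) + 0 < 2 * g
    total<2g = begin-strict
      total (2 + j) + 0  ≡⟨ +-identityʳ _ ⟩
      total (2 + j)      ≤⟨ total≤γ+excess i ⟩
      g + E   <⟨ +-monoʳ-< g e<g ⟩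
      g + g              ≡⟨ cong (g +_) (sym (+-identityʳ g)) ⟩
      2 * g              ∎
      where open ≤-Reasoning

    ¬d : ¬ Diff (3 + j) (2 * g) 0
    -- Coefficient 0 or -1 on g needs a member of D_{2+j} of size at least 2g, above M_{2+j};
    -- coefficient 1 would put g itself in D_{2+j}.
    ¬d (inj₁ d)        = <⇒≱ total<2g (diff-bound (2 + j) d)
    ¬d (inj₂ (inj₁ d)) =
      <⇒≱ total<2g (≤-trans (m≤n+m (2 * g) g) (diff-bound (2 + j) d))
    ¬d (inj₂ (inj₂ d)) = γ∉D (2 + j) (diff-+⁻ (2 + j) g
      (subst (λ x → Diff (2 + j) (g + x) (g + 0)) (+-identityʳ g) d))

  doubling : ∀ i → E ≤ i → γ (4 + (i + b)) ≡ 2 * γ (3 + (i + b))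
  doubling i e≤i = ≤-antisym (doubling-≤ i e≤i) (doubling-≥ (i + b) (m≤n+m b i))

theorem3 : ∀ (a b : ℕ) → 0 < a → a < b →
    ∃[ n₀ ] (∀ (γ : ℕ → ℕ) → IsGreedy a b γ → ∀ n → n₀ ≤ n → γ n ≡ 2 * γ (n ∸ 1))
-- Here `b` makes D_r cover an initial interval, and `E` further steps push g above the excess.
theorem3 a b 0<a a<b = 4 + (E + b) , doubles
  where
  E = totalBound (b + a) b
  doubles : ∀ γ → IsGreedy a b γ → ∀ n → 4 + (E + b) ≤ n → γ n ≡ 2 * γ (n ∸ 1)
  doubles γ greedy n n₀≤n = subst (λ n → γ n ≡ 2 * γ (n ∸ 1)) index
    (Greedy.doubling 0<a a<b greedy (E + i) (m≤m+n E i))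
    where
    i = n ∸ (4 + (E + b))
    shift-+ : ∀ x i y → 4 + (x + i + y) ≡ 4 + (x + y) + i
    shift-+ = solve-∀
    index : 4 + (E + i + b) ≡ n
    index = trans (shift-+ E i b) (m+[n∸m]≡n n₀≤n)
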